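{- Let $G$ and $H$ be connected finite simple graphs, each with at least two vertices. Then $$\sigma(G\Box H)\geq \sigma(G)+\sigma(H)-1.$$ Moreover, this lower bound is sharp: there exist connected finite simple graphs $G$ and $H$, each with at least two vertices, such that $\sigma(G\Box H)=\sigma(G)+\sigma(H)-1$.
   Context: All graphs are undirected, finite and simple. For a graph $G$, the spanning tree packing number $\sigma(G)$ is the maximum number of pairwise edge-disjoint spanning trees contained in $G$. The Cartesian product $G\Box H$ is the graph with vertex set $V(G)\times V(H)$ in which two vertices $(u,v)$ and $(u',v')$ are adjacent if and only if either $u=u'$ and $vv'\in E(H)$, or $v=v'$ and $uu'\in E(G)$. -}

module Defs where

open import Data.Bool.Base using (Bool)
open import Data.Fin.Base using (Fin; zero; suc; inject₁; fromℕ; fromℕ<; toℕ; combine; remQuot; finToFun; funToFin)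
open import Data.Fin.Properties using (all?; any?; combine-injective; remQuot-combine; finToFun-funToFin; injective⇒≤; toℕ-fromℕ<; *↔×) renaming (_≟_ to _≟ᶠ_)
open import Data.Fin.Subset using (Subset; _∈_)
open import Data.Fin.Subset.Properties using (_∈?_; anySubset?)
open import Data.List.Base using (List; []; _∷_; map; allFin)
open import Data.List.Membership.Propositional using () renaming (_∈_ to _∈ₗ_)
open import Data.List.Membership.Propositional.Properties using (∈-map⁺; ∈-allFin)
open import Data.List.Relation.Unary.Any using (here; there)
open import Data.Nat.Base using (ℕ; zero; suc; _+_; _*_; _^_; _≤_; s≤s)
open import Data.Nat.Properties using (m≤n⇒m<n∨m≡n; m≤n+m; ≤-trans; ≤-pred)
open import Data.Product.Base using (∃; _×_; _,_; proj₁; proj₂; map₂)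
open import Data.Product.Function.NonDependent.Propositional using (_×-↔_)
open import Data.Sum.Base using (_⊎_; inj₁; inj₂; [_,_]′)
open import Data.Vec.Base using (lookup; tabulate)
open import Data.Vec.Properties using (lookup∘tabulate; lookup⇒[]=; []=⇒lookup)
open import Function.Base using (_∘_)
open import Function.Bundles using (_↔_; Inverse)
open import Function.Construct.Composition using (_↔-∘_)
open import Function.Construct.Symmetry using (↔-sym)
open import Function.Definitions using (Injective)
open import Function.Properties.Inverse using (Inverse⇒Injection)
open import Level using (Level; 0ℓ)
open import Relation.Binary.Core using (Rel; _⇒_)
open import Relation.Binary.Construct.Closure.ReflexiveTransitive using (Star; ε; _◅_; _◅◅_) renaming (map to mapStar)
open import Relation.Binary.Definitions using (Symmetric; Irreflexive; DecidableEquality) renaming (Decidable to Decidable₂)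
open import Relation.Binary.PropositionalEquality using (_≡_; _≢_; refl; sym; trans; cong; cong₂; subst; subst₂)
open import Relation.Nullary using (¬_; Dec; yes; no; does; contradiction)
open import Relation.Nullary.Decidable using (map′; _×-dec_; _⊎-dec_; _→-dec_; ¬?; via-injection; dec-true)
open import Relation.Unary using (Pred; Decidable)

private
  variable
    ℓ : Level

record SimpleGraph (V : Set) : Set₁ where
  field
    Adj    : Rel V 0ℓ
    adj?   : Decidable₂ Adj
    symm   : Symmetric Adj
    irrefl : Irreflexive _≡_ Adj

module _ {V : Set} where

  open SimpleGraph

  _⊆_ : SimpleGraph V → SimpleGraph V → Set
  T ⊆ G = Adj T ⇒ Adj G

  EdgeDisjoint : SimpleGraph V → SimpleGraph V → Set
  EdgeDisjoint S T = ∀ {u v} → Adj S u v → ¬ Adj T u v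

  Connected : SimpleGraph V → Set
  Connected G = ∀ u v → Star (Adj G) u v

  -- c lists the vertices of a cycle of length 3 + k in cyclic order.
  IsCycle : ∀ {k} → SimpleGraph V → (Fin (3 + k) → V) → Set
  IsCycle {k} G c =
    Injective _≡_ _≡_ c ×
    (∀ (i : Fin (2 + k)) → Adj G (c (inject₁ i)) (c (suc i))) ×
    Adj G (c (fromℕ (2 + k))) (c zero)

  Acyclic : SimpleGraph V → Set
  Acyclic G = ∀ {k} (c : Fin (3 + k) → V) → ¬ IsCycle G c

  IsTree : SimpleGraph V → Set
  IsTree T = Connected T × Acyclic T

  -- T has the same vertex type as G, so a subgraph of this form is spanning.
  IsSpanningTree : SimpleGraph V → SimpleGraph V → Set
  IsSpanningTree G T = T ⊆ G × IsTree T

  record Packing (G : SimpleGraph V) (k : ℕ) : Set₁ where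
    field
      tree     : Fin k → SimpleGraph V
      spanning : ∀ i → IsSpanningTree G (tree i)
      disjoint : ∀ i j → i ≢ j → EdgeDisjoint (tree i) (tree j)

record Graph : Set₁ where
  field
    Vertex : Set
    order  : ℕ
    finite : Vertex ↔ Fin order
    graph  : SimpleGraph Vertex

  open SimpleGraph graph public

  infix 4 _≟_
  _≟_ : DecidableEquality Vertex
  _≟_ = via-injection (Inverse⇒Injection finite) _≟ᶠ_

open Graph using (order; graph)

infixr 7 _□_

_□_ : Graph → Graph → Graph
G □ H = record
  { Vertex = G.Vertex × H.Vertex
  ; order  = G.order * H.order
  ; finite = ↔-sym *↔× ↔-∘ (G.finite ×-↔ H.finite)
  ; graph  = record
    { Adj    = λ (u , v) (u′ , v′) → (u ≡ u′ × H.Adj v v′) ⊎ (v ≡ v′ × G.Adj u u′)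
    ; adj?   = λ (u , v) (u′ , v′) →
                 ((u G.≟ u′) ×-dec H.adj? v v′) ⊎-dec ((v H.≟ v′) ×-dec G.adj? u u′)
    ; symm   = λ { (inj₁ (p , e)) → inj₁ (sym p , H.symm e)
                 ; (inj₂ (p , e)) → inj₂ (sym p , G.symm e) }
    ; irrefl = λ { refl (inj₁ (_ , e)) → H.irrefl refl e
                 ; refl (inj₂ (_ , e)) → G.irrefl refl e }
    }
  }
  where
  module G = Graph G
  module H = Graph H

-- Existence of a packing of a given size is decided by exhaustive search.
-- This is what makes the maximum a computable number.

module Search {V : Set} {n : ℕ} (finite : V ↔ Fin n) where

  open Inverse finite using (to; from; strictlyInverseˡ; strictlyInverseʳ)
  open SimpleGraph

  to-injective : Injective _≡_ _≡_ to
  to-injective {u} {v} p =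
    trans (sym (strictlyInverseʳ u)) (trans (cong from p) (strictlyInverseʳ v))

  from-injective : Injective _≡_ _≡_ from
  from-injective {i} {j} p =
    trans (sym (strictlyInverseˡ i)) (trans (cong to p) (strictlyInverseˡ j))

  ∀? : {P : Pred V ℓ} → Decidable P → Dec (∀ v → P v)
  ∀? {P = P} P? = map′
    (λ f v → subst P (strictlyInverseʳ v) (f (to v)))
    (λ f i → f (from i))
    (all? (P? ∘ from))

  vertices : List V
  vertices = map from (allFin n)

  ∈-vertices : ∀ v → v ∈ₗ vertices
  ∈-vertices v = subst (_∈ₗ vertices) (strictlyInverseʳ v) (∈-map⁺ from (∈-allFin (to v)))

  -- Warshall's algorithm: walks whose inner vertices come from a list.

  Reach : Rel V 0ℓ → List V → Rel V 0ℓ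
  Reach R []       u v = u ≡ v ⊎ R u v
  Reach R (w ∷ ws) u v = Reach R ws u v ⊎ (Reach R ws u w × Reach R ws w v)

  reach? : {R : Rel V 0ℓ} → Decidable₂ R → ∀ ws → Decidable₂ (Reach R ws)
  reach? R? []       u v = via-injection (Inverse⇒Injection finite) _≟ᶠ_ u v ⊎-dec R? u v
  reach? R? (w ∷ ws) u v =
    reach? R? ws u v ⊎-dec (reach? R? ws u w ×-dec reach? R? ws w v)

  module _ {R : Rel V 0ℓ} where

    reach⇒star : ∀ ws {u v} → Reach R ws u v → Star R u v
    reach⇒star []       (inj₁ refl)    = ε
    reach⇒star []       (inj₂ e)       = e ◅ ε
    reach⇒star (w ∷ ws) (inj₁ p)       = reach⇒star ws p
    reach⇒star (w ∷ ws) (inj₂ (p , q)) = reach⇒star ws p ◅◅ reach⇒star ws q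

    base : ∀ ws {u v} → u ≡ v ⊎ R u v → Reach R ws u v
    base []       p = p
    base (w ∷ ws) p = inj₁ (base ws p)

    join : ∀ ws {u w v} → w ∈ₗ ws → Reach R ws u w → Reach R ws w v → Reach R ws u v
    join (w ∷ ws) (here refl) p q =
      inj₂ ([ (λ x → x) , proj₁ ]′ p , [ (λ x → x) , proj₂ ]′ q)
    join (w ∷ ws) (there m) (inj₁ p)       (inj₁ q)       = inj₁ (join ws m p q)
    join (w ∷ ws) (there m) (inj₁ p)       (inj₂ (q , r)) = inj₂ (join ws m p q , r)
    join (w ∷ ws) (there m) (inj₂ (p , q)) (inj₁ r)       = inj₂ (p , join ws m q r)
    join (w ∷ ws) (there m) (inj₂ (p , _)) (inj₂ (_ , r)) = inj₂ (p , r)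

    star⇒reach : ∀ {u v} → Star R u v → Reach R vertices u v
    star⇒reach ε        = base vertices (inj₁ refl)
    star⇒reach (e ◅ es) = join vertices (∈-vertices _) (base vertices (inj₂ e)) (star⇒reach es)

  connected? : (G : SimpleGraph V) → Dec (Connected G)
  connected? G = ∀? λ u → ∀? λ v →
    map′ (reach⇒star vertices) star⇒reach (reach? (adj? G) vertices u v)

  isCycle? : ∀ {k} (G : SimpleGraph V) (c : Fin (3 + k) → V) → Dec (IsCycle G c)
  isCycle? G c =
    map′ (λ f {i} {j} → f i j) (λ f i j → f {i} {j})
      (all? λ i → all? λ j → via-injection (Inverse⇒Injection finite) _≟ᶠ_ (c i) (c j) →-dec (i ≟ᶠ j))
    ×-dec all? (λ i → adj? G _ _)
    ×-dec adj? G _ _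

  isCycle-resp : ∀ {k} (G H : SimpleGraph V) {c d : Fin (3 + k) → V} →
                 Adj G ⇒ Adj H → (∀ i → c i ≡ d i) → IsCycle G c → IsCycle H d
  isCycle-resp G H G⇒H c≗d (inj , step , close) =
    (λ {i} {j} p → inj (trans (c≗d i) (trans p (sym (c≗d j))))) ,
    (λ i → subst₂ (Adj H) (c≗d _) (c≗d _) (G⇒H (step i))) ,
    subst₂ (Adj H) (c≗d _) (c≗d _) (G⇒H close)

  acyclic? : (G : SimpleGraph V) → Dec (Acyclic G)
  acyclic? G = map′ sound complete
    (¬? (any? λ (k : Fin n) → any? λ (x : Fin (n ^ (3 + toℕ k))) → isCycle? G (decode x)))
    where
    decode : ∀ {m} → Fin (n ^ m) → Fin m → V
    decode x i = from (finToFun x i)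

    Coded : Set
    Coded = ∃ λ (k : Fin n) → ∃ λ (x : Fin (n ^ (3 + toℕ k))) → IsCycle G (decode x)

    code : ∀ {k} (k′ : Fin n) → toℕ k′ ≡ k → (c : Fin (3 + k) → V) → IsCycle G c → Coded
    code k′ refl c cyc = k′ , funToFin (to ∘ c) , isCycle-resp G G (λ e → e)
      (λ i → sym (trans (cong from (finToFun-funToFin (to ∘ c) i)) (strictlyInverseʳ (c i)))) cyc

    sound : ¬ Coded → Acyclic G
    sound ¬coded {k} c cyc@(inj , _) = ¬coded (code (fromℕ< k<n) (toℕ-fromℕ< k<n) c cyc)
      where k<n = ≤-trans (m≤n+m (suc k) 2) (injective⇒≤ (inj ∘ to-injective))

    complete : Acyclic G → ¬ Coded
    complete acyc (_ , x , cyc) = acyc (decode x) cyc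

  module _ (G : SimpleGraph V) (k : ℕ) where

    slot : Fin k → V → V → Fin (k * (n * n))
    slot i u v = combine i (combine (to u) (to v))

    -- Every k-tuple of subgraphs of G arises from a subset of Fin (k * (n * n)).
    decode : Subset (k * (n * n)) → Fin k → SimpleGraph V
    decode S i = record
      { Adj    = λ u v → Adj G u v × slot i u v ∈ S × slot i v u ∈ S
      ; adj?   = λ u v → adj? G u v ×-dec ((slot i u v ∈? S) ×-dec (slot i v u ∈? S))
      ; symm   = λ (e , p , q) → symm G e , q , p
      ; irrefl = λ p (e , _) → irrefl G p e
      }

    Good : Subset (k * (n * n)) → Set
    Good S = (∀ i → IsTree (decode S i)) ×
             (∀ i j → i ≢ j → ∀ u v → Adj (decode S i) u v → ¬ Adj (decode S j) u v)

    good? : Decidable Good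
    good? S =
      all? (λ i → connected? (decode S i) ×-dec acyclic? (decode S i)) ×-dec
      all? (λ i → all? λ j → ¬? (i ≟ᶠ j) →-dec
        ∀? λ u → ∀? λ v → adj? (decode S i) u v →-dec ¬? (adj? (decode S j) u v))

    good⇒packing : ∃ Good → Packing G k
    good⇒packing (S , trees , disj) = record
      { tree     = decode S
      ; spanning = λ i → proj₁ , trees i
      ; disjoint = λ i j i≢j → disj i j i≢j _ _
      }

    packing⇒good : Packing G k → ∃ Good
    packing⇒good P = S , trees , disj
      where
      open Packing P

      entry : Fin k × Fin n × Fin n → Bool
      entry (i , a , b) = does (adj? (tree i) (from a) (from b))

      split : Fin (k * (n * n)) → Fin k × Fin n × Fin n
      split x = map₂ (remQuot n) (remQuot {k} (n * n) x)

      split-slot : ∀ i u v → split (slot i u v) ≡ (i , to u , to v)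
      split-slot i u v = trans
        (cong (map₂ (remQuot n)) (remQuot-combine i (combine (to u) (to v))))
        (cong (i ,_) (remQuot-combine (to u) (to v)))

      S : Subset (k * (n * n))
      S = tabulate (entry ∘ split)

      lookup-slot : ∀ i u v → lookup S (slot i u v) ≡ does (adj? (tree i) u v)
      lookup-slot i u v =
        trans (lookup∘tabulate (entry ∘ split) (slot i u v))
        (trans (cong entry (split-slot i u v))
        (cong₂ (λ a b → does (adj? (tree i) a b)) (strictlyInverseʳ u) (strictlyInverseʳ v)))

      in⁺ : ∀ i {u v} → Adj (tree i) u v → slot i u v ∈ S
      in⁺ i {u} {v} e = lookup⇒[]= _ S
        (trans (lookup-slot i u v) (dec-true (adj? (tree i) u v) e))

      in⁻ : ∀ i {u v} → slot i u v ∈ S → Adj (tree i) u v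
      in⁻ i {u} {v} p with adj? (tree i) u v | trans (sym (lookup-slot i u v)) ([]=⇒lookup p)
      ... | yes e | _  = e
      ... | no _  | ()

      encode : ∀ i → Adj (tree i) ⇒ Adj (decode S i)
      encode i e = proj₁ (spanning i) e , in⁺ i e , in⁺ i (symm (tree i) e)

      trees : ∀ i → IsTree (decode S i)
      trees i = let (_ , conn , acyc) = spanning i in
        (λ u v → mapStar (encode i) (conn u v)) ,
        (λ c cyc → acyc c (isCycle-resp (decode S i) (tree i)
          (λ (_ , p , _) → in⁻ i p) (λ _ → refl) cyc))

      disj : ∀ i j → i ≢ j → ∀ u v → Adj (decode S i) u v → ¬ Adj (decode S j) u v
      disj i j i≢j u v (_ , p , _) (_ , q , _) = disjoint i j i≢j (in⁻ i p) (in⁻ j q)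

    packing? : Dec (Packing G k)
    packing? = map′ good⇒packing packing⇒good (anySubset? good?)

  private
    first-edge : {R : Rel V 0ℓ} {u v : V} → u ≢ v → Star R u v → ∃ λ a → ∃ λ b → R a b
    first-edge u≢v ε       = contradiction refl u≢v
    first-edge u≢v (e ◅ _) = _ , _ , e

    edge : 2 ≤ n → {T : SimpleGraph V} → Connected T → ∃ λ a → ∃ λ b → Adj T a b
    edge (s≤s (s≤s _)) conn =
      first-edge (λ p → contradiction (from-injective p) λ ()) (conn (from zero) (from (suc zero)))

  packing-bound : ∀ {G k} → 2 ≤ n → Packing G k → k ≤ n * n
  packing-bound {G} {k} 2≤n P = injective⇒≤ {f = f} f-injective
    where
    open Packing P

    e : ∀ i → ∃ λ a → ∃ λ b → Adj (tree i) a b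
    e i = edge 2≤n {tree i} (proj₁ (proj₂ (spanning i)))

    f : Fin k → Fin (n * n)
    f i = let (a , b , _) = e i in combine (to a) (to b)

    f-injective : Injective _≡_ _≡_ f
    f-injective {i} {j} p with i ≟ᶠ j | combine-injective _ _ _ _ p
    ... | yes i≡j | _       = i≡j
    ... | no i≢j  | (q , r) = contradiction
      (subst₂ (Adj (tree j)) (sym (to-injective q)) (sym (to-injective r)) (proj₂ (proj₂ (e j))))
      (disjoint i j i≢j (proj₂ (proj₂ (e i))))

greatest : {P : Pred ℕ ℓ} → Decidable P → ℕ → ℕ
greatest P? zero    = zero
greatest P? (suc b) with P? (suc b)
... | yes _ = suc b
... | no  _ = greatest P? b

greatest-satisfies : {P : Pred ℕ ℓ} (P? : Decidable P) → P 0 → ∀ b → P (greatest P? b)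
greatest-satisfies P? p₀ zero    = p₀
greatest-satisfies P? p₀ (suc b) with P? (suc b)
... | yes p = p
... | no  _ = greatest-satisfies P? p₀ b

greatest-maximal : {P : Pred ℕ ℓ} (P? : Decidable P) → ∀ b {k} → k ≤ b → P k → k ≤ greatest P? b
greatest-maximal P? zero    k≤b p = k≤b
greatest-maximal P? (suc b) k≤b p with P? (suc b) | m≤n⇒m<n∨m≡n k≤b
... | yes _ | _         = k≤b
... | no ¬p | inj₁ k<sb = greatest-maximal P? b (≤-pred k<sb) p
... | no ¬p | inj₂ refl = contradiction p ¬p

-- The search range is large enough as soon as there are two vertices, by
-- σ-maximal. With at most one vertex the edgeless graph packs any number of
-- times, so there is no maximum and the value is junk.
σ : Graph → ℕ
σ G = greatest (Search.packing? (Graph.finite G) (graph G)) (order G * order G)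

σ-packing : ∀ G → Packing (graph G) (σ G)
σ-packing G = greatest-satisfies (Search.packing? (Graph.finite G) (graph G)) empty (order G * order G)
  where
  empty : Packing (graph G) 0
  empty = record { tree = λ () ; spanning = λ () ; disjoint = λ () }

σ-maximal : ∀ G → 2 ≤ order G → ∀ {k} → Packing (graph G) k → k ≤ σ G
σ-maximal G 2≤n P = greatest-maximal (Search.packing? (Graph.finite G) (graph G)) (order G * order G)
  (Search.packing-bound (Graph.finite G) 2≤n P) P

{-# OPTIONS --safe #-}
module Submission where

-- Let G and H have packings of a + 1 and b + 1 spanning trees, rooted at s and
-- r, and let S and T be the first tree of each packing. The a + b + 1 spanning
-- trees of the product come from the following disjoint connected subgraphs.
--
-- * For each of the other a trees of G: its copy in every copy of G, and for
--   every w other than r one copy of the edge of T from w to its parent, taken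
--   in the copy of H at a vertex of G that is said to be claimed for w. These
--   edges link the copies of G together (sweep).
-- * For each of the other b trees of H: the same with G and H exchanged.
-- * The unclaimed copies of the edges of S and T. They form a connected graph
--   as soon as, from every vertex (v,w) other than (s,r), the edge to the parent
--   in one of the coordinates is unclaimed: following such edges decreases the
--   sum of the distances to the roots (drop-down).
--
-- The claims thus have to avoid s and r and must not hit a pair (v,w) from both
-- sides. A tuple of a vertices for each w and of b vertices for each v achieves
-- this in a chessboard pattern: choose 2a vertices of G and 2b of H other
-- than the roots, both cut into two halves. The first half of G is claimed for
-- the w in the first half of H, and the second half of G for all other w; the
-- second half of H is claimed for the v in the first half of G, and the first
-- half of H for all other v (pick-clash). There are enough vertices since k disjoint spanning trees on m
-- vertices have k(m - 1) edges out of m(m - 1)/2, so that 2k is at most m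
-- (packing-size). Breadth-first search turns connected graphs into rooted trees
-- (rooted), and parent edges never form a cycle (forest-acyclic), so the
-- subgraphs can be thinned out to spanning trees (connected⇒packing).
--
-- The bound is attained by two copies of the complete graph on two vertices:
-- their product is a square, whose 4 edges do not suffice for two trees.

open import Defs
open import Data.Bool.Base using (true; false; if_then_else_)
open import Data.Fin.Base using (Fin; zero; suc; inject₁; fromℕ; fromℕ<; toℕ; combine; remQuot; join; splitAt; inject≤; punchIn; punchOut)
open import Data.Fin.Properties using (any?; all?; combine-injective; combine-remQuot; injective⇒≤; inject≤-injective; join-splitAt; punchIn-injective; punchInᵢ≢i; punchOut-injective; splitAt-join; suc-injective; toℕ-inject₁) renaming (_≟_ to _≟ᶠ_)
open import Data.Fin.Relation.Unary.Top using (view; ‵fromℕ; ‵inject₁)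
open import Data.List.Base using (allFin)
open import Data.List.Extrema.Nat using (argmax; f[xs]≤f[argmax])
open import Data.List.Membership.Propositional.Properties using (∈-allFin)
open import Data.List.Relation.Unary.All using () renaming (lookup to lookupAll)
open import Data.Maybe.Base using (Maybe; just; nothing) renaming (map to mapMaybe)
open import Data.Maybe.Properties using (just-injective)
open import Data.Nat.Base using (ℕ; zero; suc; _+_; _*_; _≤_; _<_; _≥_; z≤n; s≤s; s≤s⁻¹)
open import Data.Nat.Properties using (≤-refl; ≤-trans; <-trans; ≤-antisym; ≤-reflexive; <-irrefl; <⇒≱; ≮⇒≥; n<1+n; +-comm; +-suc; +-mono-≤; +-monoˡ-<; +-monoˡ-≤; ≤-<-trans; *-cancelʳ-<; +-monoʳ-<; *-assoc; *-comm; *-cancelʳ-≤; +-identityʳ; n≤1+n; *-mono-≤; m≤m+n)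
open import Data.Product.Base using (∃; ∃₂; _×_; _,_; proj₁; proj₂; swap; map₂)
open import Data.Sum.Base using (_⊎_; inj₁; inj₂) renaming (swap to swap⊎)
open import Data.Sum.Properties using (inj₁-injective; inj₂-injective)
open import Data.Unit.Base using (tt)
open import Function.Base using (_∘_; id)
open import Function.Bundles using (_↔_; Inverse)
open import Function.Construct.Identity using (↔-id)
open import Function.Definitions using (Injective)
open import Level using (0ℓ)
open import Relation.Binary.Construct.Closure.ReflexiveTransitive using (Star; ε; _◅_; _◅◅_; reverse; gmap)
open import Relation.Binary.Core using (Rel)
open import Relation.Binary.Definitions using (DecidableEquality)
open import Relation.Binary.PropositionalEquality using (_≡_; _≢_; refl; sym; trans; cong; subst; subst₂)
open import Relation.Nullary using (¬_; Dec; yes; no; does; contradiction)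
open import Relation.Nullary.Decidable using (map′; _×-dec_; _⊎-dec_; ¬?)
open import Relation.Unary using (Pred; Decidable; U)
open import Relation.Unary.Properties using (U?)
open Graph using (order; graph)
open SimpleGraph

-- Rooted spanning trees

-- A spanning tree of T presented by parent pointers towards the root s, which
-- decrease the rank. The parent of s itself is arbitrary.
record Rooted {V : Set} (T : SimpleGraph V) (s : V) : Set where
  field
    parent : V → V
    rank   : V → ℕ
    step   : ∀ {u} → u ≢ s → Adj T u (parent u)
    lower  : ∀ {u} → u ≢ s → rank (parent u) < rank u

least : {P : Pred ℕ 0ℓ} → Decidable P → ∀ d → P d →
        ∃ λ m → P m × (∀ {j} → j < m → ¬ P j)
least P? zero    p = 0 , p , λ ()
least P? (suc d) p with P? 0
... | yes p₀ = 0 , p₀ , λ ()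
... | no ¬p₀ with least (P? ∘ suc) d p
...   | m , q , below = suc m , q , λ { {zero} _ → ¬p₀ ; {suc j} (s≤s j<m) → below j<m }

-- Breadth-first search: the parent of u is the second vertex of a shortest
-- walk from u to s, and the rank is the distance to s.
module _ {V : Set} {n : ℕ} (finite : V ↔ Fin n) (_≟_ : DecidableEquality V) (T : SimpleGraph V) (s : V) where

  open Inverse finite using (to; from; strictlyInverseʳ)

  ∃? : {P : Pred V 0ℓ} → Decidable P → Dec (∃ P)
  ∃? {P} P? = map′
    (λ (i , p) → from i , p)
    (λ (v , p) → to v , subst P (sym (strictlyInverseʳ v)) p)
    (any? (P? ∘ from))

  -- Walks of a given length from a vertex to s.
  Walk : ℕ → V → Set
  Walk zero    u = u ≡ s
  Walk (suc d) u = ∃ λ w → Adj T u w × Walk d w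

  walk? : ∀ d → Decidable (Walk d)
  walk? zero    u = u ≟ s
  walk? (suc d) u = ∃? λ w → adj? T u w ×-dec walk? d w

  star⇒walk : ∀ {u} → Star (Adj T) u s → ∃ λ d → Walk d u
  star⇒walk ε        = 0 , refl
  star⇒walk (e ◅ es) = let (d , w) = star⇒walk es in suc d , _ , e , w

  rooted : Connected T → Rooted T s
  rooted conn = record
    { parent = proj₁ ∘ up
    ; rank   = distance
    ; step   = proj₁ ∘ proj₂ (up _)
    ; lower  = proj₂ ∘ proj₂ (up _)
    }
    where
    shortest : ∀ u → ∃ λ m → Walk m u × (∀ {j} → j < m → ¬ Walk j u)
    shortest u = let (d , w) = star⇒walk (conn u s) in least (λ m → walk? m u) d w

    distance : V → ℕ
    distance = proj₁ ∘ shortest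

    up : ∀ u → ∃ λ w → u ≢ s → Adj T u w × distance w < distance u
    up u with shortest u
    ... | zero  , u≡s , _            = u , λ u≢s → contradiction u≡s u≢s
    ... | suc d , (w , e , walk) , _ = w , λ _ →
      e , s≤s (≮⇒≥ λ d<w → proj₂ (proj₂ (shortest w)) d<w walk)

cycle-neighbours : ∀ {V : Set} {k} (G : SimpleGraph V) {c : Fin (3 + k) → V} → IsCycle G c → ∀ i →
  ∃₂ λ j j′ → j ≢ j′ × Adj G (c i) (c j) × Adj G (c i) (c j′)
cycle-neighbours G (_ , next , close) zero =
  suc zero , fromℕ _ , (λ ()) , next zero , symm G close
cycle-neighbours G (_ , next , close) (suc i) with view i
... | ‵fromℕ     = zero , inject₁ (fromℕ _) , (λ ()) , close , symm G (next (fromℕ _))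
... | ‵inject₁ i = suc (suc i) , inject₁ (inject₁ i) , apart , next (suc i) , symm G (next (inject₁ i))
  where
  apart : suc (suc i) ≢ inject₁ (inject₁ i)
  apart p = <-irrefl
    (sym (trans (cong toℕ p) (trans (toℕ-inject₁ (inject₁ i)) (toℕ-inject₁ i))))
    (<-trans (n<1+n _) (n<1+n _))

module _ {V : Set} (_≟_ : DecidableEquality V) {T : SimpleGraph V} {s : V} (R : Rooted T s) where

  open Rooted R

  -- The arcs from a vertex in P to its parent. As the root has no parent, it
  -- contributes none, whether or not it is in P.
  ParentEdge : Pred V 0ℓ → Rel V 0ℓ
  ParentEdge P u v = u ≢ s × parent u ≡ v × P u

  parentEdge-antisym : ∀ {P Q : Pred V 0ℓ} {u v} → ParentEdge P u v → ¬ ParentEdge Q v u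
  parentEdge-antisym {u = u} (u≢s , refl , _) (v≢s , q , _) =
    <-irrefl refl (<-trans (lower u≢s) (subst (λ w → rank w < rank (parent u)) q (lower v≢s)))

  -- The subforest of T formed by the parent edges of the vertices in P.
  forest : {P : Pred V 0ℓ} → Decidable P → SimpleGraph V
  forest {P} P? = record
    { Adj    = λ u v → ParentEdge P u v ⊎ ParentEdge P v u
    ; adj?   = λ u v → parentEdge? u v ⊎-dec parentEdge? v u
    ; symm   = swap⊎
    ; irrefl = λ { refl (inj₁ e) → parentEdge-antisym {P} {P} e e
                 ; refl (inj₂ e) → parentEdge-antisym {P} {P} e e }
    }
    where
    parentEdge? : ∀ u v → Dec (ParentEdge P u v)
    parentEdge? u v = ¬? (u ≟ s) ×-dec ((parent u ≟ v) ×-dec P? u)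

  forest⊆ : {P : Pred V 0ℓ} (P? : Decidable P) → forest P? ⊆ T
  forest⊆ P? (inj₁ (u≢s , refl , _)) = step u≢s
  forest⊆ P? (inj₂ (v≢s , refl , _)) = symm T (step v≢s)

  forest-disjoint : {P Q : Pred V 0ℓ} (P? : Decidable P) (Q? : Decidable Q) →
    (∀ {u} → P u → ¬ Q u) → EdgeDisjoint (forest P?) (forest Q?)
  forest-disjoint P? Q? P⇒¬Q (inj₁ (_ , _ , p)) (inj₁ (_ , _ , q)) = P⇒¬Q p q
  forest-disjoint {P} {Q} P? Q? P⇒¬Q (inj₁ e) (inj₂ e′) = parentEdge-antisym {P} {Q} e e′
  forest-disjoint {P} {Q} P? Q? P⇒¬Q (inj₂ e) (inj₁ e′) = parentEdge-antisym {P} {Q} e e′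
  forest-disjoint P? Q? P⇒¬Q (inj₂ (_ , _ , p)) (inj₂ (_ , _ , q)) = P⇒¬Q p q

  -- Both neighbours of a vertex of greatest rank on a cycle would be its parent.
  forest-acyclic : {P : Pred V 0ℓ} (P? : Decidable P) → Acyclic (forest P?)
  forest-acyclic {P} P? {k} c cyc@(inj , _) =
    let (j , j′ , j≢j′ , e , e′) = cycle-neighbours (forest P?) cyc top
    in j≢j′ (inj (trans (sym (parent-of j e)) (parent-of j′ e′)))
    where
    top : Fin (3 + k)
    top = argmax (rank ∘ c) zero (allFin _)

    highest : ∀ i → rank (c i) ≤ rank (c top)
    highest i = lookupAll (f[xs]≤f[argmax] {f = rank ∘ c} zero (allFin _)) (∈-allFin i)

    parent-of : ∀ i → Adj (forest P?) (c top) (c i) → parent (c top) ≡ c i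
    parent-of i (inj₁ (_ , p , _)) = p
    parent-of i (inj₂ (i≢s , p , _)) =
      contradiction (highest i) (<⇒≱ (subst (λ w → rank w < rank (c i)) p (lower i≢s)))

to-root⇒connected : ∀ {V : Set} (G : SimpleGraph V) (s : V) → (∀ u → Star (Adj G) u s) → Connected G
to-root⇒connected G s walk u v = walk u ◅◅ reverse (symm G) (walk v)

-- Walking downhill along a measure until the target can be reached.
descend : ∀ {X : Set} {E : Rel X 0ℓ} {t : X} (μ : X → ℕ) →
  (∀ x → Star E x t ⊎ ∃ λ y → Star E x y × μ y < μ x) → ∀ x → Star E x t
descend {X} {E} {t} μ closer x = go (μ x) x ≤-refl
  where
  go : ∀ d x → μ x ≤ d → Star E x t
  go d x μ≤d with closer x
  ... | inj₁ walk = walk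
  go zero    x μ≤d | inj₂ (y , walk , μ<) = contradiction (≤-trans μ< μ≤d) λ ()
  go (suc d) x μ≤d | inj₂ (y , walk , μ<) = walk ◅◅ go d y (s≤s⁻¹ (≤-trans μ< μ≤d))

-- Disjoint connected spanning subgraphs can be thinned out to spanning trees.
connected⇒packing : ∀ {V : Set} {n} (finite : V ↔ Fin n) (_≟_ : DecidableEquality V) (s : V)
  {G : SimpleGraph V} {k : ℕ} (A : Fin k → SimpleGraph V) → (∀ i → A i ⊆ G) →
  (∀ i → Connected (A i)) → (∀ i j → i ≢ j → EdgeDisjoint (A i) (A j)) → Packing G k
connected⇒packing {V} finite _≟_ s {G} {k} A A⊆G conn disj = record
  { tree     = tree
  ; spanning = λ i → (λ e → A⊆G i (tree⊆A i e)) , tree-connected i , forest-acyclic _≟_ (R i) U?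
  ; disjoint = λ i j i≢j e e′ → disj i j i≢j (tree⊆A i e) (tree⊆A j e′)
  }
  where
  R : ∀ i → Rooted (A i) s
  R i = rooted finite _≟_ (A i) s (conn i)

  tree : Fin k → SimpleGraph V
  tree i = forest _≟_ (R i) U?

  tree⊆A : ∀ i → tree i ⊆ A i
  tree⊆A i = forest⊆ _≟_ (R i) U?

  tree-connected : ∀ i → Connected (tree i)
  tree-connected i = to-root⇒connected (tree i) s (descend rank closer)
    where
    open Rooted (R i)
    closer : ∀ u → Star (Adj (tree i)) u s ⊎ ∃ λ v → Star (Adj (tree i)) u v × rank v < rank u
    closer u with u ≟ s
    ... | yes refl = inj₁ ε
    ... | no u≢s   = inj₂ (parent u , inj₁ (u≢s , refl , tt) ◅ ε , lower u≢s)

-- Counting edges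

-- Each tree of a packing has an edge for every vertex other than the root, and
-- each edge is two arcs. So a code of the arcs by Fin N bounds the packing.
arc-count : ∀ {V : Set} {n} (finite : V ↔ Fin (suc n)) (_≟_ : DecidableEquality V) (s : V)
  {G : SimpleGraph V} {k N : ℕ} → Packing G k →
  (code : ∀ {u v} → Adj G u v → Fin N) →
  (∀ {u v u′ v′} (e : Adj G u v) (e′ : Adj G u′ v′) → code e ≡ code e′ → u ≡ u′ × v ≡ v′) →
  k * (n * 2) ≤ N
arc-count {V} {n} finite _≟_ s {G} {k} {N} P code code-injective =
  injective⇒≤ {f = λ x → arc (split x)} λ p → split-injective (arc-injective _ _ p)
  where
  open Packing P
  open Inverse finite using (to; from; strictlyInverseˡ)

  Index : Set
  Index = Fin k × Fin n × Fin 2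

  split : Fin (k * (n * 2)) → Index
  split x = map₂ (remQuot 2) (remQuot {k} (n * 2) x)

  split-injective : ∀ {x y} → split x ≡ split y → x ≡ y
  split-injective {x} {y} p = trans (sym (unsplit x)) (trans (cong fuse p) (unsplit y))
    where
    fuse : Index → Fin (k * (n * 2))
    fuse (i , j , c) = combine i (combine j c)
    unsplit : ∀ x → fuse (split x) ≡ x
    unsplit x = trans (cong (combine (proj₁ (remQuot {k} (n * 2) x))) (combine-remQuot {n} 2 _))
                      (combine-remQuot {k} (n * 2) x)

  R : ∀ i → Rooted (tree i) s
  R i = rooted finite _≟_ (tree i) s (proj₁ (proj₂ (spanning i)))

  vertex : Fin n → V
  vertex j = from (punchIn (to s) j)

  vertex≢s : ∀ j → vertex j ≢ s
  vertex≢s j p = punchInᵢ≢i (to s) j (trans (sym (strictlyInverseˡ _)) (cong to p))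

  vertex-injective : ∀ {i j} → vertex i ≡ vertex j → i ≡ j
  vertex-injective p = punchIn-injective (to s) _ _ (Search.from-injective finite p)

  up : Fin k → Fin n → V
  up i j = Rooted.parent (R i) (vertex j)

  edge : ∀ i j → Adj (tree i) (vertex j) (up i j)
  edge i j = Rooted.step (R i) (vertex≢s j)

  same-tree : ∀ {u v i i′} → Adj (tree i) u v → Adj (tree i′) u v → i ≡ i′
  same-tree {i = i} {i′} e e′ with i ≟ᶠ i′
  ... | yes p = p
  ... | no  q = contradiction e′ (disjoint i i′ q e)

  -- Upward arcs have last component 0, downward arcs 1.
  arc : Index → Fin N
  arc (i , j , zero)     = code (proj₁ (spanning i) (edge i j))
  arc (i , j , suc zero) = code (proj₁ (spanning i) (symm (tree i) (edge i j)))

  parallel : ∀ {i i′ j j′} {c : Fin 2} → vertex j ≡ vertex j′ → up i j ≡ up i′ j′ →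
             _≡_ {A = Index} (i , j , c) (i′ , j′ , c)
  parallel {i} {i′} {j} {j′} p q with vertex-injective p
  ... | refl = cong (λ i → i , j , _) (same-tree {i = i} {i′}
    (edge i j) (subst (Adj (tree i′) (vertex j)) (sym q) (edge i′ j)))

  opposite : ∀ {i i′ j j′} → vertex j ≡ up i′ j′ → ¬ up i j ≡ vertex j′
  opposite {i} {i′} {j} {j′} p q with same-tree {i = i} {i′} (edge i j)
    (subst₂ (Adj (tree i′)) (sym p) (sym q) (symm (tree i′) (edge i′ j′)))
  ... | refl = parentEdge-antisym _≟_ (R i) {P = U} {Q = U}
    (vertex≢s j , q , tt) (vertex≢s j′ , sym p , tt)

  arc-injective : ∀ x y → arc x ≡ arc y → x ≡ y
  arc-injective (_ , _ , zero) (_ , _ , zero) p =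
    let (q , r) = code-injective _ _ p in parallel q r
  arc-injective (_ , _ , zero) (_ , _ , suc zero) p =
    let (q , r) = code-injective _ _ p in contradiction r (opposite q)
  arc-injective (_ , _ , suc zero) (_ , _ , zero) p =
    let (q , r) = code-injective _ _ p in contradiction q (opposite r)
  arc-injective (_ , _ , suc zero) (_ , _ , suc zero) p =
    let (q , r) = code-injective _ _ p in parallel r q

packing-size : ∀ {V : Set} {m} → V ↔ Fin m → DecidableEquality V → 2 ≤ m → V →
  {G : SimpleGraph V} {k : ℕ} → Packing G k → k * 2 ≤ m
packing-size {m = suc zero} _ _ (s≤s ())
packing-size {V} {suc (suc n)} finite _≟_ _ s {G} {k} P =
  *-cancelʳ-≤ (k * 2) (2 + n) (suc n) (≤-trans (≤-reflexive regroup) (arc-count finite _≟_ s P code code-injective))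
  where
  open Inverse finite using (to)

  regroup : k * 2 * suc n ≡ k * (suc n * 2)
  regroup = trans (*-assoc k 2 (suc n)) (cong (k *_) (*-comm 2 (suc n)))

  apart : ∀ {u v} → Adj G u v → to u ≢ to v
  apart e p = irrefl G (Search.to-injective finite p) e

  -- An arc is numbered as an ordered pair of distinct elements of Fin (2 + n).
  code : ∀ {u v} → Adj G u v → Fin ((2 + n) * suc n)
  code {u} e = combine (to u) (punchOut (apart e))

  punchOut-heads : ∀ {i i′ j j′ : Fin (2 + n)} (p : i ≢ j) (p′ : i′ ≢ j′) →
    i ≡ i′ → punchOut p ≡ punchOut p′ → j ≡ j′
  punchOut-heads p p′ refl = punchOut-injective p p′

  code-injective : ∀ {u v u′ v′} (e : Adj G u v) (e′ : Adj G u′ v′) →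
    code e ≡ code e′ → u ≡ u′ × v ≡ v′
  code-injective e e′ p =
    let (q , r) = combine-injective _ _ _ _ p
    in Search.to-injective finite q , Search.to-injective finite (punchOut-heads (apart e) (apart e′) q r)

-- Two tuples of a vertices each, all distinct and other than s.
record Spare {V : Set} (s : V) (a : ℕ) : Set where
  field
    pt           : Fin a ⊎ Fin a → V
    pt-injective : Injective _≡_ _≡_ pt
    pt≢root      : ∀ t → pt t ≢ s

spare : ∀ {V : Set} {m} → V ↔ Fin m → DecidableEquality V → 2 ≤ m → (s : V) →
  {G : SimpleGraph V} {a : ℕ} → Packing G (suc a) → Spare s a
spare {V} {suc n} finite _≟_ 2≤m s {a = a} P = record
  { pt           = pt
  ; pt-injective = λ {t} {t′} p → trans (sym (splitAt-join a a t)) (trans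
      (cong (splitAt a) (inject≤-injective 2a≤n 2a≤n _ _
        (punchIn-injective (to s) _ _ (Search.from-injective finite p))))
      (splitAt-join a a t′))
  ; pt≢root      = λ t p → punchInᵢ≢i (to s) _ (trans (sym (strictlyInverseˡ _)) (cong to p))
  }
  where
  open Inverse finite using (to; from; strictlyInverseˡ)

  2a≤n : a + a ≤ n
  2a≤n = ≤-trans (≤-reflexive (trans (sym (cong (a +_) (+-identityʳ a))) (*-comm 2 a)))
    (≤-trans (n≤1+n _) (s≤s⁻¹ (packing-size finite _≟_ 2≤m s P)))

  pt : Fin a ⊎ Fin a → V
  pt t = from (punchIn (to s) (inject≤ (join a a t) 2a≤n))

-- Distributing the parent edges

module _ {V W : Set} (_≟_ : DecidableEquality W) {a b : ℕ} (x : Fin a ⊎ Fin a → V) (y : Fin b ⊎ Fin b → W) where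

  first? : ∀ w → Dec (∃ λ j → y (inj₁ j) ≡ w)
  first? w = any? λ j → y (inj₁ j) ≟ w

  -- For w in the first half of y this is the i-th vertex of the first half of x,
  -- and for every other w the i-th vertex of the second half.
  pick : Fin a → W → V
  pick i w = if does (first? w) then x (inj₁ i) else x (inj₂ i)

  pick-injective : Injective _≡_ _≡_ x → ∀ w {i i′} → pick i w ≡ pick i′ w → i ≡ i′
  pick-injective x-inj w p with does (first? w)
  ... | true  = inj₁-injective (x-inj p)
  ... | false = inj₂-injective (x-inj p)

  pick≢ : ∀ {s} → (∀ t → x t ≢ s) → ∀ i w → pick i w ≢ s
  pick≢ x≢s i w with does (first? w)
  ... | true  = x≢s (inj₁ i)
  ... | false = x≢s (inj₂ i)

-- The chessboard: when the roles of x and y are exchanged and the halves of y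
-- swapped, no pair (v,w) is picked from both sides.
pick-clash : ∀ {V W : Set} (_≟ᵥ_ : DecidableEquality V) (_≟_ : DecidableEquality W) {a b : ℕ}
  (x : Fin a ⊎ Fin a → V) (y : Fin b ⊎ Fin b → W) →
  Injective _≡_ _≡_ x → Injective _≡_ _≡_ y → ∀ {i j v w} →
  pick _≟_ x y i w ≡ v → ¬ pick _≟ᵥ_ (y ∘ swap⊎) x j v ≡ w
pick-clash _≟ᵥ_ _≟_ x y x-inj y-inj {i} {j} {v} {w} p q with first? _≟_ x y w | first? _≟ᵥ_ (y ∘ swap⊎) x v
... | yes (j′ , r) | yes _       = contradiction (y-inj (trans r (sym q))) λ ()
... | yes _        | no v∉       = v∉ (i , p)
... | no _         | yes (_ , r) = contradiction (x-inj (trans p (sym r))) λ ()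
... | no w∉        | no _        = w∉ (j , q)

-- T is a family of graphs on W, and R is a rooted spanning tree of the first. The vertex f i w of V
-- is the one claimed for w by part i: part i gets the edge from w to its parent
-- in the copy of W at f i w.
module _ {V W : Set} (_≟ᵥ_ : DecidableEquality V) (_≟_ : DecidableEquality W) {a b : ℕ}
  (T : Fin (suc b) → SimpleGraph W) {r : W} (R : Rooted (T zero) r) (f : Fin a → W → V) where

  Claimed : Fin a → V → Pred W 0ℓ
  Claimed i v w = f i w ≡ v

  claimed? : ∀ i v → Decidable (Claimed i v)
  claimed? i v w = f i w ≟ᵥ v

  Unclaimed : V → Pred W 0ℓ
  Unclaimed v w = ∀ i → ¬ Claimed i v w

  unclaimed? : ∀ v → Decidable (Unclaimed v)
  unclaimed? v w = all? λ i → ¬? (claimed? i v w)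

  -- The edges that a part gets in the copy of W at v. The part just (inj₁ i) gets
  -- the edges that it claims, just (inj₂ j) gets the whole of T (suc j), and
  -- the part nothing gets the unclaimed edges of the rooted tree.
  layer : Maybe (Fin a ⊎ Fin b) → V → SimpleGraph W
  layer (just (inj₁ i)) v = forest _≟_ R (claimed? i v)
  layer (just (inj₂ j)) v = T (suc j)
  layer nothing         v = forest _≟_ R (unclaimed? v)

  layer⊆ : ∀ {G : SimpleGraph W} → (∀ j → T j ⊆ G) → ∀ p v → layer p v ⊆ G
  layer⊆ T⊆G (just (inj₁ i)) v e = T⊆G zero (forest⊆ _≟_ R (claimed? i v) e)
  layer⊆ T⊆G (just (inj₂ j)) v e = T⊆G (suc j) e
  layer⊆ T⊆G nothing         v e = T⊆G zero (forest⊆ _≟_ R (unclaimed? v) e)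

  layer-disjoint : (∀ w {i i′} → f i w ≡ f i′ w → i ≡ i′) →
    (∀ i j → i ≢ j → EdgeDisjoint (T i) (T j)) →
    ∀ p q → p ≢ q → ∀ v → EdgeDisjoint (layer p v) (layer q v)
  layer-disjoint f-inj T-disj = go
    where
    go : ∀ p q → p ≢ q → ∀ v → EdgeDisjoint (layer p v) (layer q v)
    go (just (inj₁ i)) (just (inj₁ i′)) p≢q v =
      forest-disjoint _≟_ R (claimed? i v) (claimed? i′ v)
        λ c c′ → p≢q (cong (just ∘ inj₁) (f-inj _ (trans c (sym c′))))
    go (just (inj₁ i)) (just (inj₂ j)) p≢q v e =
      T-disj zero (suc j) (λ ()) (forest⊆ _≟_ R (claimed? i v) e)
    go (just (inj₁ i)) nothing p≢q v =
      forest-disjoint _≟_ R (claimed? i v) (unclaimed? v) λ c u → u i c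
    go (just (inj₂ j)) (just (inj₂ j′)) p≢q v =
      T-disj (suc j) (suc j′) (p≢q ∘ cong (just ∘ inj₂) ∘ suc-injective)
    go (just (inj₂ j)) nothing p≢q v e e′ =
      T-disj zero (suc j) (λ ()) (forest⊆ _≟_ R (unclaimed? v) e′) e
    go nothing nothing p≢q v = contradiction refl p≢q
    go (just (inj₂ j)) (just (inj₁ i)) p≢q v e e′ = go (just (inj₁ i)) (just (inj₂ j)) (p≢q ∘ sym) v e′ e
    go nothing (just (inj₁ i)) p≢q v e e′ = go (just (inj₁ i)) nothing (p≢q ∘ sym) v e′ e
    go nothing (just (inj₂ j)) p≢q v e e′ = go (just (inj₂ j)) nothing (p≢q ∘ sym) v e′ e

-- Subgraphs of the product

-- The spanning subgraph of the product with A v as the part in the copy of W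
-- at v, and B w as the part in the copy of V at w.
weave : ∀ {V W : Set} → DecidableEquality V → DecidableEquality W →
  (V → SimpleGraph W) → (W → SimpleGraph V) → SimpleGraph (V × W)
weave _≟ᵥ_ _≟_ A B = record
  { Adj    = λ (v , w) (v′ , w′) → (v ≡ v′ × Adj (A v) w w′) ⊎ (w ≡ w′ × Adj (B w) v v′)
  ; adj?   = λ (v , w) (v′ , w′) →
      ((v ≟ᵥ v′) ×-dec adj? (A v) w w′) ⊎-dec ((w ≟ w′) ×-dec adj? (B w) v v′)
  ; symm   = λ { {v , _} (inj₁ (refl , e)) → inj₁ (refl , symm (A v) e)
               ; {_ , w} (inj₂ (refl , e)) → inj₂ (refl , symm (B w) e) }
  ; irrefl = λ { {v , _} refl (inj₁ (_ , e)) → irrefl (A v) refl e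
               ; {_ , w} refl (inj₂ (_ , e)) → irrefl (B w) refl e }
  }

weave-disjoint : ∀ {V W : Set} (_≟ᵥ_ : DecidableEquality V) (_≟_ : DecidableEquality W)
  (A A′ : V → SimpleGraph W) (B B′ : W → SimpleGraph V) →
  (∀ v → EdgeDisjoint (A v) (A′ v)) → (∀ w → EdgeDisjoint (B w) (B′ w)) →
  EdgeDisjoint (weave _≟ᵥ_ _≟_ A B) (weave _≟ᵥ_ _≟_ A′ B′)
weave-disjoint _≟ᵥ_ _≟_ A A′ B B′ dA dB {v , w} (inj₁ (_ , e))    (inj₁ (_ , e′))   = dA v e e′
weave-disjoint _≟ᵥ_ _≟_ A A′ B B′ dA dB {v , w} (inj₁ (refl , _)) (inj₂ (_ , e′))   = irrefl (B′ w) refl e′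
weave-disjoint _≟ᵥ_ _≟_ A A′ B B′ dA dB {v , w} (inj₂ (refl , _)) (inj₁ (_ , e′))   = irrefl (A′ v) refl e′
weave-disjoint _≟ᵥ_ _≟_ A A′ B B′ dA dB {v , w} (inj₂ (_ , e))    (inj₂ (_ , e′))   = dB w e e′

-- If every copy of V is connected, and for every w some edge leads from the
-- copy at w to the copy at its parent, then everything is connected to (s,r).
sweep : ∀ {V W : Set} → DecidableEquality W → {T : SimpleGraph W} {r : W} (R : Rooted T r) {s : V}
  {E : Rel (V × W) 0ℓ} → (∀ w v v′ → Star E (v , w) (v′ , w)) →
  (∀ w → w ≢ r → ∃ λ v → E (v , w) (v , Rooted.parent R w)) → ∀ x → Star E x (s , r)
sweep {V} {W} _≟_ {r = r} R {s} {E} across hop = descend (rank ∘ proj₂) closer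
  where
  open Rooted R
  closer : ∀ x → Star E x (s , r) ⊎ ∃ λ y → Star E x y × rank (proj₂ y) < rank (proj₂ x)
  closer (v , w) with w ≟ r
  ... | yes refl = inj₁ (across r v s)
  ... | no w≢r   = let (v′ , e) = hop w w≢r in
    inj₂ (_ , across w v v′ ◅◅ (e ◅ ε) , lower w≢r)

-- If from every vertex other than (s,r) one of the two coordinates can be
-- replaced by its parent, then everything is connected to (s,r).
drop-down : ∀ {V W : Set} {S : SimpleGraph V} {s : V} (Q : Rooted S s)
  {T : SimpleGraph W} {r : W} (R : Rooted T r)
  {E : Rel (V × W) 0ℓ} →
  (∀ v w → (v ≡ s × w ≡ r) ⊎ (v ≢ s × E (v , w) (Rooted.parent Q v , w)) ⊎
             (w ≢ r × E (v , w) (v , Rooted.parent R w))) →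
  ∀ x → Star E x (s , r)
drop-down {V} {W} {s = s} Q {r = r} R {E} choice = descend μ closer
  where
  open Rooted
  μ : V × W → ℕ
  μ (v , w) = rank Q v + rank R w
  closer : ∀ x → Star E x (s , r) ⊎ ∃ λ y → Star E x y × μ y < μ x
  closer (v , w) with choice v w
  ... | inj₁ (refl , refl)      = inj₁ ε
  ... | inj₂ (inj₁ (v≢s , e)) = inj₂ (_ , e ◅ ε , +-monoˡ-< (rank R w) (lower Q v≢s))
  ... | inj₂ (inj₂ (w≢r , e)) = inj₂ (_ , e ◅ ε , +-monoʳ-< (rank Q v) (lower R w≢r))

-- The numbering of the parts: just (inj₁ i) extends tree i + 1 of G, just (inj₂ j)
-- extends tree j + 1 of H, and nothing is the part of the unclaimed edges.
part : ∀ a b → Fin (suc (a + b)) → Maybe (Fin a ⊎ Fin b)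
part a b zero    = nothing
part a b (suc i) = just (splitAt a i)

part-injective : ∀ a b {i j} → part a b i ≡ part a b j → i ≡ j
part-injective a b {zero}  {zero}  _ = refl
part-injective a b {suc i} {suc j} p = cong suc (trans (sym (join-splitAt a b i))
  (trans (cong (join a b) (just-injective p)) (join-splitAt a b j)))

-- The a + b + 1 parts assembled from the layers in the two directions.
module _ (G H : Graph) (2≤G : 2 ≤ order G) (2≤H : 2 ≤ order H) (s : Graph.Vertex G) (r : Graph.Vertex H)
  {a b : ℕ} (P : Packing (graph G) (suc a)) (Q : Packing (graph H) (suc b)) where

  private
    module G = Graph G
    module H = Graph H
    module P = Packing P
    module Q = Packing Q
    module X = Spare (spare G.finite G._≟_ 2≤G s P)
    module Y = Spare (spare H.finite H._≟_ 2≤H r Q)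

    RP : Rooted (P.tree zero) s
    RP = rooted G.finite G._≟_ (P.tree zero) s (proj₁ (proj₂ (P.spanning zero)))

    RQ : Rooted (Q.tree zero) r
    RQ = rooted H.finite H._≟_ (Q.tree zero) r (proj₁ (proj₂ (Q.spanning zero)))

    φ : Fin a → H.Vertex → G.Vertex
    φ = pick H._≟_ X.pt Y.pt

    ψ : Fin b → G.Vertex → H.Vertex
    ψ = pick G._≟_ (Y.pt ∘ swap⊎) X.pt

    swap⊎-injective : ∀ {A B : Set} → Injective _≡_ _≡_ (swap⊎ {A = A} {B = B})
    swap⊎-injective {x = inj₁ _} {y = inj₁ _} refl = refl
    swap⊎-injective {x = inj₂ _} {y = inj₂ _} refl = refl

    -- The same part, seen with G and H exchanged.
    swapped : Maybe (Fin a ⊎ Fin b) → Maybe (Fin b ⊎ Fin a)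
    swapped = mapMaybe swap⊎

    swapped-injective : ∀ {p q} → swapped p ≡ swapped q → p ≡ q
    swapped-injective {just _}  {just _}  p = cong just (swap⊎-injective (just-injective p))
    swapped-injective {nothing} {nothing} _ = refl

    layerH : Maybe (Fin a ⊎ Fin b) → G.Vertex → SimpleGraph H.Vertex
    layerH = layer G._≟_ H._≟_ Q.tree RQ φ

    layerG : Maybe (Fin a ⊎ Fin b) → H.Vertex → SimpleGraph G.Vertex
    layerG p = layer H._≟_ G._≟_ P.tree RP ψ (swapped p)

    piece : Maybe (Fin a ⊎ Fin b) → SimpleGraph (G.Vertex × H.Vertex)
    piece p = weave G._≟_ H._≟_ (layerH p) (layerG p)

    piece⊆ : ∀ p → piece p ⊆ graph (G □ H)
    piece⊆ p {v , w} (inj₁ (q , e)) = inj₁ (q ,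
      layer⊆ G._≟_ H._≟_ Q.tree RQ φ {H.graph} (λ j → proj₁ (Q.spanning j)) p v e)
    piece⊆ p {v , w} (inj₂ (q , e)) = inj₂ (q ,
      layer⊆ H._≟_ G._≟_ P.tree RP ψ {G.graph} (λ i → proj₁ (P.spanning i)) (swapped p) w e)

    piece-disjoint : ∀ p q → p ≢ q → EdgeDisjoint (piece p) (piece q)
    piece-disjoint p q p≢q = weave-disjoint G._≟_ H._≟_ (layerH p) (layerH q) (layerG p) (layerG q)
      (layer-disjoint G._≟_ H._≟_ Q.tree RQ φ (pick-injective H._≟_ X.pt Y.pt X.pt-injective) Q.disjoint p q p≢q)
      (layer-disjoint H._≟_ G._≟_ P.tree RP ψ
        (pick-injective G._≟_ (Y.pt ∘ swap⊎) X.pt (swap⊎-injective ∘ Y.pt-injective))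
        P.disjoint (swapped p) (swapped q) (p≢q ∘ swapped-injective {p} {q}))

    piece-to-root : ∀ p x → Star (Adj (piece p)) x (s , r)
    piece-to-root (just (inj₁ i)) = sweep H._≟_ RQ
      (λ w v v′ → gmap (_, w) (λ e → inj₂ (refl , e)) (proj₁ (proj₂ (P.spanning (suc i))) v v′))
      (λ w w≢r → φ i w , inj₁ (refl , inj₁ (w≢r , refl , refl)))
    piece-to-root (just (inj₂ j)) (v , w) = gmap swap id
      (sweep G._≟_ RP {E = λ x y → Adj (piece (just (inj₂ j))) (swap x) (swap y)}
        (λ v w w′ → gmap (_, v) (λ e → inj₁ (refl , e)) (proj₁ (proj₂ (Q.spanning (suc j))) w w′))
        (λ v v≢s → ψ j v , inj₂ (refl , inj₁ (v≢s , refl , refl)))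
        (w , v))
    piece-to-root nothing = drop-down RP RQ choice
      where
      E : Rel (G.Vertex × H.Vertex) 0ℓ
      E = Adj (piece nothing)

      alongG : ∀ v w → v ≢ s → (∀ j → ψ j v ≢ w) → E (v , w) (Rooted.parent RP v , w)
      alongG v w v≢s free = inj₂ (refl , inj₁ (v≢s , refl , free))

      alongH : ∀ v w → w ≢ r → (∀ i → φ i w ≢ v) → E (v , w) (v , Rooted.parent RQ w)
      alongH v w w≢r free = inj₁ (refl , inj₁ (w≢r , refl , free))

      choice : ∀ v w → (v ≡ s × w ≡ r) ⊎ (v ≢ s × E (v , w) (Rooted.parent RP v , w)) ⊎
                       (w ≢ r × E (v , w) (v , Rooted.parent RQ w))
      choice v w with v G.≟ s | w H.≟ r
      ... | yes v≡s | yes w≡r  = inj₁ (v≡s , w≡r)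
      ... | yes refl | no w≢r  = inj₂ (inj₂ (w≢r , alongH v w w≢r λ i →
        pick≢ H._≟_ X.pt Y.pt X.pt≢root i w))
      ... | no v≢s  | yes refl = inj₂ (inj₁ (v≢s , alongG v w v≢s λ j →
        pick≢ G._≟_ (Y.pt ∘ swap⊎) X.pt (Y.pt≢root ∘ swap⊎) j v))
      ... | no v≢s  | no w≢r with any? (λ i → φ i w G.≟ v)
      ...   | no free       = inj₂ (inj₂ (w≢r , alongH v w w≢r λ i p → free (i , p)))
      ...   | yes (i , p) = inj₂ (inj₁ (v≢s , alongG v w v≢s λ j →
        pick-clash G._≟_ H._≟_ X.pt Y.pt X.pt-injective Y.pt-injective p))

  □-packing : Packing (graph (G □ H)) (suc (a + b))
  □-packing = connected⇒packing (Graph.finite (G □ H)) (Graph._≟_ (G □ H)) (s , r)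
    (piece ∘ part a b) (λ i → piece⊆ (part a b i))
    (λ i → to-root⇒connected (piece (part a b i)) (s , r) (piece-to-root (part a b i)))
    (λ i j i≢j → piece-disjoint (part a b i) (part a b j) (i≢j ∘ part-injective a b))

-- The bound and its sharpness

some-vertex : ∀ (G : Graph) → 2 ≤ order G → Graph.Vertex G
some-vertex G 2≤n = Inverse.from (Graph.finite G) (fromℕ< (≤-trans (s≤s z≤n) 2≤n))

1≤σ : ∀ (G : Graph) → Connected (graph G) → 2 ≤ order G → 1 ≤ σ G
1≤σ G conn 2≤n = σ-maximal G 2≤n
  (connected⇒packing (Graph.finite G) (Graph._≟_ G) (some-vertex G 2≤n) {k = 1}
    (λ _ → graph G) (λ _ e → e) (λ _ → conn) λ { zero zero 0≢0 → contradiction refl 0≢0 })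

packings⇒≤σ : ∀ (G H : Graph) → 2 ≤ order G → 2 ≤ order H → ∀ {k l} → 1 ≤ k → 1 ≤ l →
  Packing (graph G) k → Packing (graph H) l → k + l ≤ σ (G □ H) + 1
packings⇒≤σ G H 2≤G 2≤H {suc a} {suc b} _ _ P Q = ≤-trans
  (≤-reflexive (trans (+-suc (suc a) b) (+-comm 1 (suc (a + b)))))
  (+-monoˡ-≤ 1 (σ-maximal (G □ H) (≤-trans (s≤s (s≤s z≤n)) (*-mono-≤ 2≤G 2≤H))
    (□-packing G H 2≤G 2≤H (some-vertex G 2≤G) (some-vertex H 2≤H) P Q)))

σ-□ : ∀ (G H : Graph) → Connected (graph G) → Connected (graph H) →
  2 ≤ order G → 2 ≤ order H → σ G + σ H ≤ σ (G □ H) + 1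
σ-□ G H cG cH 2≤G 2≤H =
  packings⇒≤σ G H 2≤G 2≤H (1≤σ G cG 2≤G) (1≤σ H cH 2≤H) (σ-packing G) (σ-packing H)

-- Equality holds for G with itself when the square of G has no two disjoint
-- spanning trees, for then all three packing numbers are 1.
σ-□-sharp : ∀ (G : Graph) → Connected (graph G) → 2 ≤ order G →
  (∀ {k} → Packing (graph (G □ G)) k → k ≤ 1) → σ (G □ G) + 1 ≡ σ G + σ G
σ-□-sharp G conn 2≤n at-most-1 = ≤-antisym
  (≤-trans (+-monoˡ-≤ 1 (at-most-1 (σ-packing (G □ G)))) (+-mono-≤ (1≤σ G conn 2≤n) (1≤σ G conn 2≤n)))
  (σ-□ G G conn conn 2≤n 2≤n)

K₂ : Graph
K₂ = record
  { Vertex = Fin 2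
  ; order  = 2
  ; finite = ↔-id (Fin 2)
  ; graph  = record
    { Adj    = _≢_
    ; adj?   = λ u v → ¬? (u ≟ᶠ v)
    ; symm   = λ u≢v → u≢v ∘ sym
    ; irrefl = λ p u≢v → u≢v p
    }
  }

K₂-connected : Connected (graph K₂)
K₂-connected u v with u ≟ᶠ v
... | yes refl = ε
... | no u≢v   = u≢v ◅ ε

-- The square has 8 arcs, and two disjoint spanning trees would have 12.
square-packing : ∀ {k} → Packing (graph (K₂ □ K₂)) k → k ≤ 1
square-packing {k} P = s≤s⁻¹ (*-cancelʳ-< 6 k 2 (≤-<-trans
  (arc-count (Graph.finite (K₂ □ K₂)) (Graph._≟_ (K₂ □ K₂)) (zero , zero) P code
    (λ {x} {y} {x′} {y′} → code-injective {x} {y} {x′} {y′}))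
  (m≤m+n 9 3)))
  where
  -- An arc is given by its start and the coordinate that changes.
  direction : ∀ {x y} → Adj (graph (K₂ □ K₂)) x y → Fin 2
  direction (inj₁ _) = zero
  direction (inj₂ _) = suc zero

  code : ∀ {x y} → Adj (graph (K₂ □ K₂)) x y → Fin 8
  code {u , v} e = combine u (combine v (direction e))

  other : ∀ {u v v′ : Fin 2} → u ≢ v → u ≢ v′ → v ≡ v′
  other {zero}     {zero}     {_}        p _ = contradiction refl p
  other {zero}     {suc zero} {zero}     _ q = contradiction refl q
  other {zero}     {suc zero} {suc zero} _ _ = refl
  other {suc zero} {zero}     {zero}     _ _ = refl
  other {suc zero} {zero}     {suc zero} _ q = contradiction refl q
  other {suc zero} {suc zero} {_}        p _ = contradiction refl p

  same-end : ∀ {x y y′} (e : Adj (graph (K₂ □ K₂)) x y) (e′ : Adj (graph (K₂ □ K₂)) x y′) →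
    direction e ≡ direction e′ → y ≡ y′
  same-end (inj₁ (refl , p)) (inj₁ (refl , q)) _ = cong (_ ,_) (other p q)
  same-end (inj₂ (refl , p)) (inj₂ (refl , q)) _ = cong (_, _) (other p q)

  code-injective : ∀ {x y x′ y′} (e : Adj (graph (K₂ □ K₂)) x y) (e′ : Adj (graph (K₂ □ K₂)) x′ y′) →
    code {x} {y} e ≡ code {x′} {y′} e′ → x ≡ x′ × y ≡ y′
  code-injective {u , v} {_} {u′ , v′} e e′ p
    with combine-injective u (combine v (direction e)) u′ (combine v′ (direction e′)) p
  ... | refl , q with combine-injective v (direction e) v′ (direction e′) q
  ...   | refl , r = refl , same-end e e′ r

theorem1 : (∀ (G H : Graph) → Connected (graph G) → Connected (graph H) →
    2 ≤ order G → 2 ≤ order H →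
    σ (G □ H) + 1 ≥ σ G + σ H)
    × (∃₂ λ (G H : Graph) → Connected (graph G) × Connected (graph H) ×
    2 ≤ order G × 2 ≤ order H ×
    σ (G □ H) + 1 ≡ σ G + σ H)
theorem1 = σ-□ , K₂ , K₂ , K₂-connected , K₂-connected , ≤-refl , ≤-refl ,
  σ-□-sharp K₂ K₂-connected ≤-refl square-packing
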